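{- (Soundness) Let $\mathfrak M=(\mathfrak T,\mathcal V)$ be a TFL model and $\phi$ a TFL formula in positive normal form, and let $H_0=(\mathfrak X(s_0),t_\epsilon)$ be the initial process. If $H_0\notin[\![\phi]\!]^{\mathfrak T}_{\mathcal V}$, then Adam has a winning strategy in the model-checking game $\mathcal G(H_0,\phi)$.
   Context: Systems: $\mathfrak T=(S,s_0,T,I,\Sigma)$, a transition system with independence (states $S$, initial $s_0$, labels $\Sigma$, transitions $T\subseteq S\times\Sigma\times S$, irreflexive symmetric independence $I\subseteq T\times T$ satisfying the standard TSI axioms), image-finite. For $t=(s,a,s')$: $\sigma(t)=s,\tau(t)=s',\delta(t)=a$. $t\otimes t'$ iff $\sigma(t)=\sigma(t')\wedge tIt'$; $t\ominus t'$ iff $\tau(t)=\sigma(t')\wedge tIt'$; $t\le t'$ iff $\tau(t)=\sigma(t')\wedge\neg tIt'$. $\mathfrak X(s)$ = transitions with source $s$; conflict-free set = set with common source, pairwise $\otimes$; support sets = the $\mathfrak X(s)$ and non-empty conflict-free sets; $M\sqsubseteq R$ iff $M\subseteq R$ and no $t\in R\setminus M$ has $t\otimes t'$ for all $t'\in M$; $\mathcal X$ = all $\mathfrak X(s)$ and all support sets $M\sqsubseteq\mathfrak X(s)$; $\mathfrak A=T\cup\{t_\epsilon\}$ with fresh $t_\epsilon$, $\tau(t_\epsilon)=s_0$, $t_\epsilon\le t$ whenever $\sigma(t)=s_0$, never $t_\epsilon\ominus t$; processes $\mathfrak S=\mathcal X\times\mathfrak A$. TFL: formulas $\phi::=Z\mid\neg\phi\mid\phi\wedge\phi\mid\langle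 a\rangle_c\phi\mid\langle a\rangle_{nc}\phi\mid\langle\otimes\rangle\phi\mid\mu Z.\phi$ (free occurrences of $Z$ in $\mu Z.\phi$ under an even number of negations), with duals $\vee$, $[a]_c=\neg\langle a\rangle_c\neg$, $[a]_{nc}$, $[\otimes]=\neg\langle\otimes\rangle\neg$, $\nu Z.\phi=\neg\mu Z.\neg\phi[\neg Z/Z]$. A model is $(\mathfrak T,\mathcal V)$ with $\mathcal V:\mathrm{Var}\to2^{\mathfrak S}$. Semantics in $2^{\mathfrak S}$: $[\![Z]\!]=\mathcal V(Z)$, $\neg$ complement, $\wedge$ intersection, $[\![\langle a\rangle_c\phi]\!]=\{(R,t):\exists r\in R.\ \delta(r)=a,\ t\le r,\ (\mathfrak X(\tau(r)),r)\in[\![\phi]\!]\}$, $\langle a\rangle_{nc}$ likewise with $t\ominus r$, $[\![\langle\otimes\rangle\phi]\!]=\{(R,t):\exists M\in\mathcal X.\ M\sqsubseteq R,\ (M,t)\in[\![\phi]\!]\}$, $[\![\mu Z.\phi]\!]_{\mathcal V}=\bigcap\{Q\subseteq\mathfrak S:[\![\phi]\!]_{\mathcal V[Z:=Q]}\subseteq Q\}$. Positive normal form: negation only on variables, no two binders bind the same variable. $Sub(\phi)$ is the set of subformulas. Model-checking game $\mathcal G(H_0,\phi)$ between Eve and Adam: configurations $H\vdash\psi$ with $H\in\mathfrak S$, $\psi\in Sub(\phi)$; start $H_0\vdash\phi$. Rules: $H\vdash\mu Z.\psi$ or $H\vdash\nu Z.\psi$ moves to $H\vdash Z$; $H\vdash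 Z$ with $Z$ bound by $\mu Z.\psi$ or $\nu Z.\psi$ moves to $H\vdash\psi$; at $H\vdash\psi_0\vee\psi_1$ Eve (at $\wedge$, Adam) chooses $H\vdash\psi_i$; at $(R,t)\vdash\langle a\rangle_c\psi$ Eve (at $[a]_c\psi$, Adam) chooses $r\in R$ with $\delta(r)=a$, $t\le r$, moving to $(\mathfrak X(\tau(r)),r)\vdash\psi$; same for $\langle a\rangle_{nc}$/$[a]_{nc}$ with $t\ominus r$; at $(R,t)\vdash\langle\otimes\rangle\psi$ Eve (at $[\otimes]\psi$, Adam) chooses $M\in\mathcal X$ with $M\sqsubseteq R$, moving to $(M,t)\vdash\psi$. Adam wins a play iff it ends at $H\vdash Z$ ($Z$ free) with $H\notin\mathcal V(Z)$, or at a diamond configuration ($\langle a\rangle_c$, $\langle a\rangle_{nc}$, $\langle\otimes\rangle$) with no available choice, or is infinite and the syntactically outermost variable occurring infinitely often is bound by a $\mu$; Eve wins dually (ends at $H\vdash Z$ with $H\in\mathcal V(Z)$, at a box configuration with no available choice, or infinite with the outermost infinitely-often variable bound by a $\nu$). A player has a winning strategy if she/he can guarantee winning every play. -}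

module Defs where

open import Axiom.ExcludedMiddle using (ExcludedMiddle)
open import Data.Bool.Base using (Bool; not; if_then_else_) renaming (T to True; _∧_ to _∧ᵇ_)
open import Data.Empty using (⊥)
open import Data.Irrelevant using (pure)
open import Data.List.Base using (List; []; _∷_; _++_)
open import Data.List.Membership.Propositional using () renaming (_∈_ to _∈ˡ_)
open import Data.Maybe.Base using (Maybe; just; nothing)
open import Data.Nat.Base using (ℕ; zero; suc) renaming (_≤_ to _≤ⁿ_)
open import Data.Parity.Base using (Parity; 0ℙ; _⁻¹)
open import Data.Product.Base using (Σ-syntax; ∃; ∃-syntax; _×_; _,_; proj₁; proj₂)
open import Data.Refinement using (Refinement-syntax; value) renaming (_,_ to _,ʳ_)
open import Data.Sum.Base using (_⊎_; inj₁; inj₂)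
open import Data.Unit.Base using (⊤)
open import Level using (0ℓ)
open import Relation.Binary.Construct.Closure.Equivalence using (EqClosure)
open import Relation.Binary.Construct.Closure.Symmetric using (SymClosure)
open import Relation.Binary.Core using (Rel)
open import Relation.Binary.Definitions using (DecidableEquality; Irreflexive; Symmetric)
open import Relation.Binary.PropositionalEquality.Core using (_≡_; _≢_)
open import Relation.Nullary.Decidable.Core using (does)
open import Relation.Nullary.Negation.Core using (¬_)
open import Relation.Unary using (Pred)

------------------------------------------------------------------------
-- Transition systems with independence

module Independence {S Label : Set} (I : Rel (S × Label × S) 0ℓ) where

  -- Two occurrences of the same action on opposite sides of an
  -- independence square.
  data _≺_ : Rel (S × Label × S) 0ℓ where
    square : ∀ {s s₁ s₂ q a b} →
             I (s , a , s₁) (s , b , s₂) →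
             I (s , a , s₁) (s₁ , b , q) →
             I (s , b , s₂) (s₂ , a , q) →
             (s , a , s₁) ≺ (s₂ , a , q)

  _∼_ : Rel (S × Label × S) 0ℓ
  _∼_ = EqClosure _≺_

-- The four axioms are those of Winskel and Nielsen.
record TSI : Set₁ where
  field
    S     : Set
    s₀    : S
    Label : Set
    T     : Pred (S × Label × S) 0ℓ
    I     : Rel (S × Label × S) 0ℓ

  open Independence I public

  field
    I⊆T×T  : ∀ {t u} → I t u → T t × T u
    irrefl : Irreflexive _≡_ I
    sym    : Symmetric I
    axiom₁ : ∀ {s a s₁ s₂} → (s , a , s₁) ∼ (s , a , s₂) → s₁ ≡ s₂
    axiom₂ : ∀ {s a s₁ b s₂} → I (s , a , s₁) (s , b , s₂) →
             ∃[ q ] I (s , a , s₁) (s₁ , b , q) × I (s , b , s₂) (s₂ , a , q)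
    axiom₃ : ∀ {s a s₁ b q} → I (s , a , s₁) (s₁ , b , q) →
             ∃[ s₂ ] I (s , a , s₁) (s , b , s₂) × I (s , b , s₂) (s₂ , a , q)
    axiom₄ : ∀ {t u v} → SymClosure _≺_ t u → I u v → I t v

  -- The proof component is irrelevant, so this is a genuine subset of
  -- S × Label × S.
  Transition : Set
  Transition = [ t ∈ S × Label × S ∣ T t ]

  σ τ : Transition → S
  σ t = proj₁ (value t)
  τ t = proj₂ (proj₂ (value t))

  δ : Transition → Label
  δ t = proj₁ (proj₂ (value t))

  _⊗_ : Rel Transition 0ℓ
  t ⊗ u = σ t ≡ σ u × I (value t) (value u)

  -- 𝔄 = T ∪ {t_ε}
  𝔄 : Set
  𝔄 = Maybe Transition

  tε : 𝔄
  tε = nothing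

  _⊖_ _≤_ : 𝔄 → Transition → Set
  just t  ⊖ r = τ t ≡ σ r × I (value t) (value r)
  nothing ⊖ r = ⊥
  just t  ≤ r = τ t ≡ σ r × ¬ I (value t) (value r)
  nothing ≤ r = s₀ ≡ σ r

ImageFinite : TSI → Set
ImageFinite 𝔗 = ∀ s a → Σ[ ys ∈ List S ] (∀ {s′} → T (s , a , s′) → s′ ∈ˡ ys)
  where open TSI 𝔗

------------------------------------------------------------------------
-- Everything below is relative to excluded middle. It makes the type
-- Subset A of characteristic functions the full powerset of A, closed
-- under comprehension with respect to arbitrary (small) predicates; since
-- Subset A is itself small, so is the quantification over all Q ⊆ 𝔖 in
-- the semantics of μ.

module TFL (em : ExcludedMiddle 0ℓ) (𝔗 : TSI) (Var : Set) where

  open TSI 𝔗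

  Subset : Set → Set
  Subset A = A → Bool

  infix 4 _∈_ _∉_ _⊆_

  _∈_ _∉_ : {A : Set} → A → Subset A → Set
  x ∈ Q = True (Q x)
  x ∉ Q = ¬ (x ∈ Q)

  _⊆_ : {A : Set} → Subset A → Subset A → Set
  P ⊆ Q = ∀ {x} → x ∈ P → x ∈ Q

  ⟪_⟫ : {A : Set} → Pred A 0ℓ → Subset A
  ⟪ P ⟫ x = does (em {P x})

  _≟_ : {A : Set} → DecidableEquality A
  x ≟ y = em

  ----------------------------------------------------------------------
  -- Processes

  𝔛 : S → Subset Transition
  𝔛 s = ⟪ (λ t → σ t ≡ s) ⟫

  _≐_ : Rel (Subset Transition) 0ℓ
  P ≐ Q = P ⊆ Q × Q ⊆ P

  -- As ⊗ is irreflexive, "pairwise" refers to distinct elements.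
  ConflictFree : Pred (Subset Transition) 0ℓ
  ConflictFree M = (∀ {t u} → t ∈ M → u ∈ M → σ t ≡ σ u)
                 × (∀ {t u} → t ∈ M → u ∈ M → t ≢ u → t ⊗ u)

  SupportSet : Pred (Subset Transition) 0ℓ
  SupportSet M = (∃[ s ] M ≐ 𝔛 s) ⊎ ((∃[ t ] t ∈ M) × ConflictFree M)

  _⊑_ : Rel (Subset Transition) 0ℓ
  M ⊑ R = M ⊆ R
        × ¬ (∃[ t ] t ∈ R × t ∉ M × (∀ {u} → u ∈ M → t ⊗ u))

  In𝒳 : Pred (Subset Transition) 0ℓ
  In𝒳 M = (∃[ s ] M ≐ 𝔛 s) ⊎ (SupportSet M × ∃[ s ] M ⊑ 𝔛 s)

  𝒳 : Set
  𝒳 = [ M ∈ Subset Transition ∣ In𝒳 M ]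

  𝔛ₓ : S → 𝒳
  𝔛ₓ s = 𝔛 s ,ʳ pure (inj₁ (s , (λ t∈ → t∈) , (λ t∈ → t∈)))

  𝔖 : Set
  𝔖 = 𝒳 × 𝔄

  initialProcess : 𝔖
  initialProcess = 𝔛ₓ s₀ , tε

  ----------------------------------------------------------------------
  -- Formulas. The modalities are ⟨a⟩_c, ⟨a⟩_nc and ⟨⊗⟩.

  data Modality : Set where
    c nc : Label → Modality
    ⊗    : Modality

  data Formula : Set where
    var  : Var → Formula
    ∼_   : Formula → Formula
    _⩓_  : Formula → Formula → Formula
    ⟨_⟩_ : Modality → Formula → Formula
    mu   : Var → Formula → Formula

  -- Every free occurrence of Z in φ is under a number of negations whose
  -- parity is p.
  Under : Parity → Var → Formula → Set
  Under p Z (var Y)   = Z ≡ Y → p ≡ 0ℙ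
  Under p Z (∼ φ)     = Under (p ⁻¹) Z φ
  Under p Z (φ ⩓ ψ)   = Under p Z φ × Under p Z ψ
  Under p Z (⟨ m ⟩ φ) = Under p Z φ
  Under p Z (mu Y φ)  = Z ≢ Y → Under p Z φ

  WellFormed : Formula → Set
  WellFormed (var Z)   = ⊤
  WellFormed (∼ φ)     = WellFormed φ
  WellFormed (φ ⩓ ψ)   = WellFormed φ × WellFormed ψ
  WellFormed (⟨ m ⟩ φ) = WellFormed φ
  WellFormed (mu Z φ)  = Under 0ℙ Z φ × WellFormed φ

  -- φ [¬ Z ] is φ[¬Z/Z]; this substitution cannot capture.
  _[¬_] : Formula → Var → Formula
  var Y     [¬ Z ] = if does (Z ≟ Y) then ∼ var Y else var Y
  (∼ φ)     [¬ Z ] = ∼ (φ [¬ Z ])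
  (φ ⩓ ψ)   [¬ Z ] = (φ [¬ Z ]) ⩓ (ψ [¬ Z ])
  (⟨ m ⟩ φ) [¬ Z ] = ⟨ m ⟩ (φ [¬ Z ])
  mu Y φ    [¬ Z ] = if does (Z ≟ Y) then mu Y φ else mu Y (φ [¬ Z ])

  ----------------------------------------------------------------------
  -- Formulas with negation only on variables, written with the duals

  data Fixpoint : Set where
    μ ν : Fixpoint

  data PNF : Set where
    pos neg : Var → PNF
    _∧_ _∨_ : PNF → PNF → PNF
    ⟨_⟩_    : Modality → PNF → PNF
    [_]_    : Modality → PNF → PNF
    fix     : Fixpoint → Var → PNF → PNF

  ⌜_⌝ : PNF → Formula
  ⌜ pos Z ⌝     = var Z
  ⌜ neg Z ⌝     = ∼ var Z
  ⌜ φ ∧ ψ ⌝     = ⌜ φ ⌝ ⩓ ⌜ ψ ⌝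
  ⌜ φ ∨ ψ ⌝     = ∼ ((∼ ⌜ φ ⌝) ⩓ (∼ ⌜ ψ ⌝))
  ⌜ ⟨ m ⟩ φ ⌝   = ⟨ m ⟩ ⌜ φ ⌝
  ⌜ [ m ] φ ⌝   = ∼ (⟨ m ⟩ (∼ ⌜ φ ⌝))
  ⌜ fix μ Z φ ⌝ = mu Z ⌜ φ ⌝
  ⌜ fix ν Z φ ⌝ = ∼ mu Z (∼ (⌜ φ ⌝ [¬ Z ]))

  binders : PNF → List Var
  binders (pos Z)     = []
  binders (neg Z)     = []
  binders (φ ∧ ψ)     = binders φ ++ binders ψ
  binders (φ ∨ ψ)     = binders φ ++ binders ψ
  binders (⟨ m ⟩ φ)   = binders φ
  binders ([ m ] φ)   = binders φ
  binders (fix η Z φ) = Z ∷ binders φ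

  ----------------------------------------------------------------------
  -- Semantics

  -- H —[ m ]→ H′: the process H′ may be chosen at H for the modality m.
  data _—[_]→_ : 𝔖 → Modality → 𝔖 → Set where
    causal     : ∀ {R t a} r → r ∈ value R → δ r ≡ a → t ≤ r →
                 (R , t) —[ c a ]→ (𝔛ₓ (τ r) , just r)
    concurrent : ∀ {R t a} r → r ∈ value R → δ r ≡ a → t ⊖ r →
                 (R , t) —[ nc a ]→ (𝔛ₓ (τ r) , just r)
    restrict   : ∀ {R t} (M : 𝒳) → value M ⊑ value R →
                 (R , t) —[ ⊗ ]→ (M , t)

  Valuation : Set
  Valuation = Var → Subset 𝔖

  _[_≔_] : Valuation → Var → Subset 𝔖 → Valuation
  (𝒱 [ Z ≔ Q ]) Y = if does (Z ≟ Y) then Q else 𝒱 Y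

  ⟦_⟧ : Formula → Valuation → Subset 𝔖
  ⟦ var Z ⟧   𝒱 = 𝒱 Z
  ⟦ ∼ φ ⟧     𝒱 = λ H → not (⟦ φ ⟧ 𝒱 H)
  ⟦ φ ⩓ ψ ⟧   𝒱 = λ H → ⟦ φ ⟧ 𝒱 H ∧ᵇ ⟦ ψ ⟧ 𝒱 H
  ⟦ ⟨ m ⟩ φ ⟧ 𝒱 = ⟪ (λ H → ∃[ H′ ] (H —[ m ]→ H′) × H′ ∈ ⟦ φ ⟧ 𝒱) ⟫
  ⟦ mu Z φ ⟧  𝒱 = ⟪ (λ H → ∀ (Q : Subset 𝔖) → ⟦ φ ⟧ (𝒱 [ Z ≔ Q ]) ⊆ Q → H ∈ Q) ⟫

  ----------------------------------------------------------------------
  -- Subformulas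

  -- A proof of ψ ∈Sub φ is an occurrence of ψ in φ. Occurrences, rather
  -- than bare formulas, tell which binder (if any) a variable belongs to,
  -- also when the same variable has both free and bound occurrences. The
  -- variable following a fixpoint operator counts as an occurrence.
  data _∈Sub_ : PNF → PNF → Set where
    root   : ∀ {φ} → φ ∈Sub φ
    ∧₀     : ∀ {φ ψ₀ ψ₁} → (ψ₀ ∧ ψ₁) ∈Sub φ → ψ₀ ∈Sub φ
    ∧₁     : ∀ {φ ψ₀ ψ₁} → (ψ₀ ∧ ψ₁) ∈Sub φ → ψ₁ ∈Sub φ
    ∨₀     : ∀ {φ ψ₀ ψ₁} → (ψ₀ ∨ ψ₁) ∈Sub φ → ψ₀ ∈Sub φ
    ∨₁     : ∀ {φ ψ₀ ψ₁} → (ψ₀ ∨ ψ₁) ∈Sub φ → ψ₁ ∈Sub φ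
    under⟨⟩ : ∀ {φ m ψ} → (⟨ m ⟩ ψ) ∈Sub φ → ψ ∈Sub φ
    under[] : ∀ {φ m ψ} → ([ m ] ψ) ∈Sub φ → ψ ∈Sub φ
    variable-of : ∀ {φ η Z ψ} → fix η Z ψ ∈Sub φ → pos Z ∈Sub φ
    body-of     : ∀ {φ η Z ψ} → fix η Z ψ ∈Sub φ → ψ ∈Sub φ

  record Binder (φ : PNF) : Set where
    constructor binder
    field
      {kind}  : Fixpoint
      {name}  : Var
      {scope} : PNF
      at      : fix kind name scope ∈Sub φ

  -- The innermost binder of Z enclosing the given occurrence.
  binderOf : ∀ {φ ψ} → Var → ψ ∈Sub φ → Maybe (Binder φ)
  binderOf Z root        = nothing
  binderOf Z (∧₀ o)      = binderOf Z o
  binderOf Z (∧₁ o)      = binderOf Z o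
  binderOf Z (∨₀ o)      = binderOf Z o
  binderOf Z (∨₁ o)      = binderOf Z o
  binderOf Z (under⟨⟩ o) = binderOf Z o
  binderOf Z (under[] o) = binderOf Z o
  binderOf Z (variable-of {Z = Y} o) =
    if does (Z ≟ Y) then just (binder o) else binderOf Z o
  binderOf Z (body-of {Z = Y} o) =
    if does (Z ≟ Y) then just (binder o) else binderOf Z o

  ----------------------------------------------------------------------
  -- The game 𝒢(H₀, φ)

  module Game (𝒱 : Valuation) (H₀ : 𝔖) (φ : PNF) where

    record Config : Set where
      constructor _⊢_
      field
        process    : 𝔖
        {formula}  : PNF
        occurrence : formula ∈Sub φ

    open Config public

    initial : Config
    initial = H₀ ⊢ root

    infix 4 _⟶_

    data _⟶_ : Rel Config 0ℓ where
      enter  : ∀ {H η Z ψ} {o : fix η Z ψ ∈Sub φ} →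
               (H ⊢ o) ⟶ (H ⊢ variable-of o)
      unfold : ∀ {H Z} {o : pos Z ∈Sub φ} {b : Binder φ} →
               binderOf Z o ≡ just b → (H ⊢ o) ⟶ (H ⊢ body-of (Binder.at b))
      or₀    : ∀ {H ψ₀ ψ₁} {o : (ψ₀ ∨ ψ₁) ∈Sub φ} → (H ⊢ o) ⟶ (H ⊢ ∨₀ o)
      or₁    : ∀ {H ψ₀ ψ₁} {o : (ψ₀ ∨ ψ₁) ∈Sub φ} → (H ⊢ o) ⟶ (H ⊢ ∨₁ o)
      and₀   : ∀ {H ψ₀ ψ₁} {o : (ψ₀ ∧ ψ₁) ∈Sub φ} → (H ⊢ o) ⟶ (H ⊢ ∧₀ o)
      and₁   : ∀ {H ψ₀ ψ₁} {o : (ψ₀ ∧ ψ₁) ∈Sub φ} → (H ⊢ o) ⟶ (H ⊢ ∧₁ o)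
      dia    : ∀ {H H′ m ψ} {o : (⟨ m ⟩ ψ) ∈Sub φ} →
               H —[ m ]→ H′ → (H ⊢ o) ⟶ (H′ ⊢ under⟨⟩ o)
      box    : ∀ {H H′ m ψ} {o : ([ m ] ψ) ∈Sub φ} →
               H —[ m ]→ H′ → (H ⊢ o) ⟶ (H′ ⊢ under[] o)

    Stuck : Pred Config 0ℓ
    Stuck C = ∀ {C′} → ¬ (C ⟶ C′)

    data AdamChooses : Pred Config 0ℓ where
      at-∧ : ∀ {H ψ₀ ψ₁} {o : (ψ₀ ∧ ψ₁) ∈Sub φ} → AdamChooses (H ⊢ o)
      at-□ : ∀ {H m ψ} {o : ([ m ] ψ) ∈Sub φ} → AdamChooses (H ⊢ o)

    -- Run h C is a partial play ending in C, with the earlier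
    -- configurations listed in h, most recent first.
    data Run : List Config → Config → Set where
      start : Run [] initial
      step  : ∀ {h C C′} → Run h C → C ⟶ C′ → Run (C ∷ h) C′

    history : (ℕ → Config) → ℕ → List Config
    history π zero    = []
    history π (suc n) = π n ∷ history π n

    data Play : Set where
      finite   : ∀ {h C} → Run h C → Stuck C → Play
      infinite : (π : ℕ → Config) → (∀ n → Run (history π n) (π n)) → Play

    ----------------------------------------------------------------------
    -- Winning

    -- The outcome of a finite play ending at H ⊢ ψ. For well-formed φ such
    -- a play ends at a literal only if its variable is free there, and
    -- never at ∧, ∨ or a fixpoint.
    AdamWinsAt : 𝔖 → PNF → Set
    AdamWinsAt H (pos Z)     = H ∉ 𝒱 Z
    AdamWinsAt H (neg Z)     = H ∈ 𝒱 Z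
    AdamWinsAt H (⟨ m ⟩ ψ)   = ⊤
    AdamWinsAt H ([ m ] ψ)   = ⊥
    AdamWinsAt H (ψ₀ ∧ ψ₁)   = ⊥
    AdamWinsAt H (ψ₀ ∨ ψ₁)   = ⊥
    AdamWinsAt H (fix η Z ψ) = ⊥

    InfinitelyOften : Var → (ℕ → Config) → Set
    InfinitelyOften Z π = ∀ n → ∃[ m ] n ≤ⁿ m × formula (π m) ≡ pos Z

    -- Y is outside Z, both bound in φ, when the binder of Z is a
    -- subformula of that of Y.
    OutermostIs : Fixpoint → (ℕ → Config) → Set
    OutermostIs η π =
      ∃[ Z ] ∃[ ψ ] fix η Z ψ ∈Sub φ × InfinitelyOften Z π ×
        (∀ {Y θ χ} → InfinitelyOften Y π → fix θ Y χ ∈Sub φ →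
           fix θ Y χ ∈Sub fix η Z ψ)

    AdamWins : Play → Set
    AdamWins (finite {C = C} _ _) = AdamWinsAt (process C) (formula C)
    AdamWins (infinite π _)       = OutermostIs μ π

    record Strategy : Set where
      field
        choose : List Config → Config → Config
        legal  : ∀ {h C C′} → AdamChooses C → C ⟶ C′ → C ⟶ choose h C

    open Strategy public

    Respects : ∀ {h C} → Strategy → Run h C → Set
    Respects s start = ⊤
    Respects s (step {h} {C} {C′} ρ _) =
      Respects s ρ × (AdamChooses C → C′ ≡ choose s h C)

    Follows : Strategy → Play → Set
    Follows s (finite ρ _)   = Respects s ρ
    Follows s (infinite _ ρ) = ∀ n → Respects s (ρ n)

    AdamHasWinningStrategy : Set
    AdamHasWinningStrategy = Σ[ s ∈ Strategy ] (∀ p → Follows s p → AdamWins p)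

{-# OPTIONS --safe #-}
module Submission where

-- Read from Adam's side, a ν is a least fixpoint, and a process outside it
-- leaves at some stage of its iteration; stages are well-founded trees, so no
-- ordinals are needed. Adam keeps to configurations H ⊢ ψ with H outside the
-- value of ψ, where each enclosing μ is interpreted by a post-fixed point of
-- the dual operator and each enclosing ν by a stage. Unfolding a ν lowers its
-- stage and leaves the stages of the binders around it alone. In an infinite
-- play, the binder unfolded at the least depth that recurs is the outermost
-- one, and it cannot be a ν, as its stage would then decrease forever.

open import Axiom.ExcludedMiddle using (ExcludedMiddle)
open import Data.Bool.Base using (true; false; not; if_then_else_)
  renaming (T to True; _∧_ to _∧ᵇ_)
open import Data.Bool.Properties using (T?; T-∧)
open import Data.Empty using (⊥)
open import Data.List.Base using (List; []; _∷_; _++_; map)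
open import Data.List.Membership.Propositional using () renaming (_∈_ to _∈ˡ_)
open import Data.List.Membership.Propositional.Properties using (∈-++⁺ˡ; ∈-++⁺ʳ)
open import Data.List.Properties using (map-++)
open import Data.List.Relation.Unary.All as All using ()
open import Data.List.Relation.Unary.All.Properties using (map⁻)
open import Data.List.Relation.Unary.AllPairs using ([]; _∷_)
open import Data.List.Relation.Unary.Any using (here; there)
open import Data.List.Relation.Unary.Unique.Propositional using (Unique)
open import Data.Maybe.Base using (Maybe; just; nothing)
open import Data.Nat.Base using (ℕ; zero; suc; _+_; _∸_; _⊔_; _≡ᵇ_; _≤_; _<_; z≤n; s≤s; s≤s⁻¹)
open import Data.Nat.Properties
open import Data.Parity.Base using (0ℙ; _⁻¹)
open import Data.Product.Base using (Σ-syntax; ∃; ∃-syntax; _×_; _,_; proj₁; proj₂)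
open import Data.Sum.Base using (_⊎_; inj₁; inj₂)
open import Data.Unit.Base using (⊤; tt)
open import Function.Base using (_∘_)
open import Function.Bundles using (mk⇔; module Equivalence)
open import Induction.WellFounded using (WellFounded; Acc; acc)
open import Level using (0ℓ)
open import Relation.Binary.Core using (Rel)
open import Relation.Binary.PropositionalEquality
  using (_≡_; _≢_; refl; sym; trans; cong; cong₂; subst)
open import Relation.Nullary.Decidable
  using (Dec; does; yes; no; decidable-stable; dec-true; dec-false; does-⇔)
open import Relation.Nullary.Negation using (¬_; contradiction)
open import Relation.Unary using (Pred)

open import Defs

-- Booleans, classical logic, recurring minima and well-founded descent

not⁺ : ∀ {b} → ¬ True b → True (not b)
not⁺ {false} _ = tt
not⁺ {true}  h = h tt

not⁻ : ∀ {b} → True (not b) → ¬ True b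
not⁻ {false} _ = λ ()

module _ (em : ExcludedMiddle 0ℓ) where

  ¬∀⇒∃¬ : {A : Set} {P : A → Set} → ¬ (∀ x → P x) → ∃[ x ] ¬ P x
  ¬∀⇒∃¬ h = decidable-stable em λ none →
    h λ x → decidable-stable em λ ¬p → none (x , ¬p)

  RecurringMinimum : (ℕ → ℕ) → Set
  RecurringMinimum f =
    ∃[ d ] (∃[ N ] (∀ {m} → N ≤ m → d ≤ f m)) × (∀ n → ∃[ m ] n ≤ m × f m ≡ d)

  -- The candidate `d` is an eventual lower bound; if it does not recur, `suc d` is one from some
  -- point on. The bound on `f` ends the search, and `fuel` counts the candidates left.
  recurring-minimum : (f : ℕ → ℕ) (bound : ℕ) → (∀ n → f n ≤ bound) → RecurringMinimum f
  recurring-minimum f bound f≤ = search (suc bound) 0 (s≤s (m≤m+n bound 0)) (0 , λ _ → z≤n)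
    where
    search : ∀ fuel d → bound < fuel + d → (∃[ N ] (∀ {m} → N ≤ m → d ≤ f m)) →
      RecurringMinimum f
    search zero d bound<d (N , d≤f) =
      contradiction (≤-trans bound<d (≤-trans (d≤f ≤-refl) (f≤ N))) 1+n≰n
    search (suc fuel) d bound< (N , d≤f) with em {∀ n → ∃[ m ] n ≤ m × f m ≡ d}
    ... | yes recurs = d , (N , d≤f) , recurs
    ... | no ¬recurs with ¬∀⇒∃¬ ¬recurs
    ... | N′ , never =
      search fuel (suc d) (subst (bound <_) (sym (+-suc fuel d)) bound<)
        (N ⊔ N′ , λ N⊔N′≤m →
          ≤∧≢⇒< (d≤f (≤-trans (m≤m⊔n N N′) N⊔N′≤m))
            λ d≡ → never (_ , ≤-trans (m≤n⊔m N N′) N⊔N′≤m , sym d≡))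

-- Well-founded induction on the current value; `until` walks along equal values to the first strict
-- drop, where the induction hypothesis applies.
no-infinite-descent : {A : Set} {_≺_ : Rel A 0ℓ} → WellFounded _≺_ → (a : ℕ → A) →
  (∀ n → a (suc n) ≡ a n ⊎ a (suc n) ≺ a n) →
  ¬ (∀ n → ∃[ m ] n ≤ m × a (suc m) ≺ a m)
no-infinite-descent {_≺_ = _≺_} wf a weak strict = from 0 (wf (a 0))
  where
  from : ∀ n → Acc _≺_ (a n) → ⊥
  until : ∀ {x} → (∀ {y} → y ≺ x → Acc _≺_ y) →
    ∀ n k → a n ≡ x → ¬ (a (suc (k + n)) ≺ a (k + n))
  from n (acc below) with strict n
  ... | m , n≤m , drop =
    until below n _ refl (subst (λ j → a (suc j) ≺ a j) (sym (m∸n+n≡m n≤m)) drop)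
  until below n zero refl drop = from (suc n) (below drop)
  until below n (suc k) refl drop with weak n
  ... | inj₂ lower = from (suc n) (below lower)
  ... | inj₁ same  =
    until below (suc n) k same (subst (λ j → a (suc j) ≺ a j) (sym (+-suc k n)) drop)

unique-map⇒injective : {A B : Set} (f : A → B) {xs : List A} → Unique (map f xs) →
  ∀ {x y} → x ∈ˡ xs → y ∈ˡ xs → f x ≡ f y → x ≡ y
unique-map⇒injective f _ (here refl) (here refl) _ = refl
unique-map⇒injective f (fresh ∷ _) (here refl) (there y∈) eq =
  contradiction eq (All.lookup (map⁻ fresh) y∈)
unique-map⇒injective f (fresh ∷ _) (there x∈) (here refl) eq =
  contradiction (sym eq) (All.lookup (map⁻ fresh) x∈)
unique-map⇒injective f (_ ∷ unique) (there x∈) (there y∈) eq =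
  unique-map⇒injective f unique x∈ y∈ eq

push : {A : Set} → ℕ → A → (ℕ → Maybe A) → ℕ → Maybe A
push n a g d = if does (d ≟ n) then just a else g d

push-top : ∀ {A : Set} n (a : A) g → push n a g n ≡ just a
push-top n a g rewrite dec-true (n ≟ n) refl = refl

push-below : ∀ {A : Set} {n d} (a : A) g → d < n → push n a g d ≡ g d
push-below {n = n} {d} a g d<n rewrite dec-false (d ≟ n) (<⇒≢ d<n) = refl

push⁻ : ∀ {A : Set} n (a : A) g {d x} → push n a g d ≡ just x → a ≡ x ⊎ g d ≡ just x
push⁻ n a g {d} eq with d ≡ᵇ n
push⁻ n a g refl | true  = inj₁ refl
push⁻ n a g eq   | false = inj₂ eq

<-+-≤ : ∀ d {a b n} → a < b → d + b ≤ n → suc d + a ≤ n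
<-+-≤ d {a} {b} a<b = ≤-trans (subst (_≤ d + b) (+-suc d a) (+-monoʳ-≤ d a<b))

module Refutation (em : ExcludedMiddle 0ℓ) (𝔗 : TSI) (Var : Set) where

  open TFL em 𝔗 Var renaming (_≟_ to _≟ⱽ_)

  em⁺ : {P : Set} → P → True (does (em {P}))
  em⁺ {P} p with em {P}
  ... | yes _  = tt
  ... | no  ¬p = ¬p p

  em⁻ : {P : Set} → True (does (em {P})) → P
  em⁻ {P} _ with em {P}
  ... | yes p = p

  -- Polarity and the substitution φ[¬Z/Z]

  -- In positive normal form only a negated literal can spoil the parity, so no count of negations
  -- is carried along.
  Positive : Var → PNF → Set
  Positive Z (pos Y)     = ⊤
  Positive Z (neg Y)     = Z ≢ Y
  Positive Z (φ ∧ ψ)     = Positive Z φ × Positive Z ψ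
  Positive Z (φ ∨ ψ)     = Positive Z φ × Positive Z ψ
  Positive Z (⟨ m ⟩ φ)   = Positive Z φ
  Positive Z ([ m ] φ)   = Positive Z φ
  Positive Z (fix η Y φ) = Z ≢ Y → Positive Z φ

  BindsPositively : PNF → Set
  BindsPositively (pos Y)     = ⊤
  BindsPositively (neg Y)     = ⊤
  BindsPositively (φ ∧ ψ)     = BindsPositively φ × BindsPositively ψ
  BindsPositively (φ ∨ ψ)     = BindsPositively φ × BindsPositively ψ
  BindsPositively (⟨ m ⟩ φ)   = BindsPositively φ
  BindsPositively ([ m ] φ)   = BindsPositively φ
  BindsPositively (fix η Z φ) = Positive Z φ × BindsPositively φ

  under-[¬]-other : ∀ {Y Z} φ {p} → Z ≢ Y → Under p Z (φ [¬ Y ]) → Under p Z φ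
  under-[¬]-other {Y} (var X) Z≢Y u with Y ≟ⱽ X
  ... | yes refl = λ Z≡Y → contradiction Z≡Y Z≢Y
  ... | no  _    = u
  under-[¬]-other (∼ φ)     Z≢Y u         = under-[¬]-other φ Z≢Y u
  under-[¬]-other (φ ⩓ ψ)   Z≢Y (u₀ , u₁) = under-[¬]-other φ Z≢Y u₀ , under-[¬]-other ψ Z≢Y u₁
  under-[¬]-other (⟨ m ⟩ φ) Z≢Y u         = under-[¬]-other φ Z≢Y u
  under-[¬]-other {Y} (mu X φ) Z≢Y u with Y ≟ⱽ X
  ... | yes _ = u
  ... | no  _ = λ Z≢X → under-[¬]-other φ Z≢Y (u Z≢X)

  -- Each free `Z` gains exactly one negation, so the parity flips.
  under-[¬]-same : ∀ {Z} φ {p} → Under p Z (φ [¬ Z ]) → Under (p ⁻¹) Z φ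
  under-[¬]-same {Z} (var X) u with Z ≟ⱽ X
  ... | yes refl = u
  ... | no  Z≢X  = λ Z≡X → contradiction Z≡X Z≢X
  under-[¬]-same (∼ φ)     u         = under-[¬]-same φ u
  under-[¬]-same (φ ⩓ ψ)   (u₀ , u₁) = under-[¬]-same φ u₀ , under-[¬]-same ψ u₁
  under-[¬]-same (⟨ m ⟩ φ) u         = under-[¬]-same φ u
  under-[¬]-same {Z} (mu X φ) u with Z ≟ⱽ X
  ... | yes Z≡X = λ Z≢X → contradiction Z≡X Z≢X
  ... | no  _   = λ Z≢X → under-[¬]-same φ (u Z≢X)

  wellFormed-[¬] : ∀ {Z} φ → WellFormed (φ [¬ Z ]) → WellFormed φ
  wellFormed-[¬] (var X)   _         = tt
  wellFormed-[¬] (∼ φ)     w         = wellFormed-[¬] φ w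
  wellFormed-[¬] (φ ⩓ ψ)   (w₀ , w₁) = wellFormed-[¬] φ w₀ , wellFormed-[¬] ψ w₁
  wellFormed-[¬] (⟨ m ⟩ φ) w         = wellFormed-[¬] φ w
  wellFormed-[¬] {Z} (mu X φ) w with Z ≟ⱽ X
  ... | yes _   = w
  ... | no  Z≢X = under-[¬]-other φ (Z≢X ∘ sym) (proj₁ w) , wellFormed-[¬] φ (proj₂ w)

  positive : ∀ {Z} φ → Under 0ℙ Z ⌜ φ ⌝ → Positive Z φ
  positive (pos Y)     _         = tt
  positive (neg Y)     u         = λ Z≡Y → contradiction (u Z≡Y) λ ()
  positive (φ ∧ ψ)     (u₀ , u₁) = positive φ u₀ , positive ψ u₁
  positive (φ ∨ ψ)     (u₀ , u₁) = positive φ u₀ , positive ψ u₁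
  positive (⟨ m ⟩ φ)   u         = positive φ u
  positive ([ m ] φ)   u         = positive φ u
  positive (fix μ Y φ) u         = λ Z≢Y → positive φ (u Z≢Y)
  positive (fix ν Y φ) u         = λ Z≢Y → positive φ (under-[¬]-other ⌜ φ ⌝ Z≢Y (u Z≢Y))

  bindsPositively : ∀ φ → WellFormed ⌜ φ ⌝ → BindsPositively φ
  bindsPositively (pos Y)     _         = tt
  bindsPositively (neg Y)     _         = tt
  bindsPositively (φ ∧ ψ)     (w₀ , w₁) = bindsPositively φ w₀ , bindsPositively ψ w₁
  bindsPositively (φ ∨ ψ)     (w₀ , w₁) = bindsPositively φ w₀ , bindsPositively ψ w₁
  bindsPositively (⟨ m ⟩ φ)   w         = bindsPositively φ w
  bindsPositively ([ m ] φ)   w         = bindsPositively φ w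
  bindsPositively (fix μ Z φ) (u , w)   = positive φ u , bindsPositively φ w
  -- The negation in front of the body and the one that the substitution puts on `Z` cancel.
  bindsPositively (fix ν Z φ) (u , w)   =
    positive φ (under-[¬]-same ⌜ φ ⌝ u) , bindsPositively φ (wellFormed-[¬] ⌜ φ ⌝ w)

  -- Both sides are Booleans obtained from `em`, and equivalent propositions yield the same Boolean.
  ⟨⟩-cong : ∀ m φ ψ {𝒱 𝒲} → (∀ H → ⟦ φ ⟧ 𝒱 H ≡ ⟦ ψ ⟧ 𝒲 H) →
            ∀ H → ⟦ ⟨ m ⟩ φ ⟧ 𝒱 H ≡ ⟦ ⟨ m ⟩ ψ ⟧ 𝒲 H
  ⟨⟩-cong m φ ψ φ≗ψ H = does-⇔ (mk⇔
    (λ (H′ , mv , h) → H′ , mv , subst True (φ≗ψ H′) h)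
    (λ (H′ , mv , h) → H′ , mv , subst True (sym (φ≗ψ H′)) h)) em em

  mu-cong : ∀ Z φ ψ {𝒱 𝒲} →
            (∀ Q H → ⟦ φ ⟧ (𝒱 [ Z ≔ Q ]) H ≡ ⟦ ψ ⟧ (𝒲 [ Z ≔ Q ]) H) →
            ∀ H → ⟦ mu Z φ ⟧ 𝒱 H ≡ ⟦ mu Z ψ ⟧ 𝒲 H
  mu-cong Z φ ψ φ≗ψ H = does-⇔ (mk⇔
    (λ least Q closed → least Q λ {H′} h → closed (subst True (φ≗ψ Q H′) h))
    (λ least Q closed → least Q λ {H′} h → closed (subst True (sym (φ≗ψ Q H′)) h))) em em

  ⟦⟧-cong : ∀ φ {𝒱 𝒲} → (∀ Z H → 𝒱 Z H ≡ 𝒲 Z H) → ∀ H → ⟦ φ ⟧ 𝒱 H ≡ ⟦ φ ⟧ 𝒲 H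
  ⟦⟧-cong (var Z)   𝒱≗𝒲 H = 𝒱≗𝒲 Z H
  ⟦⟧-cong (∼ φ)     𝒱≗𝒲 H = cong not (⟦⟧-cong φ 𝒱≗𝒲 H)
  ⟦⟧-cong (φ ⩓ ψ)   𝒱≗𝒲 H = cong₂ _∧ᵇ_ (⟦⟧-cong φ 𝒱≗𝒲 H) (⟦⟧-cong ψ 𝒱≗𝒲 H)
  ⟦⟧-cong (⟨ m ⟩ φ) 𝒱≗𝒲   = ⟨⟩-cong m φ φ (⟦⟧-cong φ 𝒱≗𝒲)
  ⟦⟧-cong (mu Z φ) {𝒱} {𝒲} 𝒱≗𝒲 = mu-cong Z φ φ λ Q → ⟦⟧-cong φ (updated Q)
    where
    updated : ∀ Q Y H → (𝒱 [ Z ≔ Q ]) Y H ≡ (𝒲 [ Z ≔ Q ]) Y H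
    updated Q Y H with Z ≟ⱽ Y
    ... | yes _ = refl
    ... | no  _ = 𝒱≗𝒲 Y H

  -- `𝒲` is `𝒱` with the value of `Z` complemented: the substitution is traded for a change of
  -- valuation.
  ⟦[¬]⟧ : ∀ Z φ {𝒱 𝒲} → (∀ H → 𝒲 Z H ≡ not (𝒱 Z H)) →
          (∀ Y → Z ≢ Y → ∀ H → 𝒲 Y H ≡ 𝒱 Y H) →
          ∀ H → ⟦ φ [¬ Z ] ⟧ 𝒱 H ≡ ⟦ φ ⟧ 𝒲 H
  ⟦[¬]⟧ Z (var Y) flipped same H with Z ≟ⱽ Y
  ... | yes refl = sym (flipped H)
  ... | no  Z≢Y  = sym (same Y Z≢Y H)
  ⟦[¬]⟧ Z (∼ φ)     flipped same H = cong not (⟦[¬]⟧ Z φ flipped same H)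
  ⟦[¬]⟧ Z (φ ⩓ ψ)   flipped same H =
    cong₂ _∧ᵇ_ (⟦[¬]⟧ Z φ flipped same H) (⟦[¬]⟧ Z ψ flipped same H)
  ⟦[¬]⟧ Z (⟨ m ⟩ φ) flipped same   = ⟨⟩-cong m (φ [¬ Z ]) φ (⟦[¬]⟧ Z φ flipped same)
  ⟦[¬]⟧ Z (mu Y φ) {𝒱} {𝒲} flipped same with Z ≟ⱽ Y
  -- A binder of the same variable stops the substitution and overwrites the only value at which the
  -- valuations differ.
  ... | yes refl = mu-cong Z φ φ λ Q → ⟦⟧-cong φ (shadowed Q)
    where
    shadowed : ∀ Q X H → (𝒱 [ Z ≔ Q ]) X H ≡ (𝒲 [ Z ≔ Q ]) X H
    shadowed Q X H with Z ≟ⱽ X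
    ... | yes _   = refl
    ... | no  Z≢X = sym (same X Z≢X H)
  ... | no Z≢Y = mu-cong Y (φ [¬ Z ]) φ λ Q → ⟦[¬]⟧ Z φ (flipped′ Q) (same′ Q)
    where
    flipped′ : ∀ Q H → (𝒲 [ Y ≔ Q ]) Z H ≡ not ((𝒱 [ Y ≔ Q ]) Z H)
    flipped′ Q H with Y ≟ⱽ Z
    ... | yes Y≡Z = contradiction (sym Y≡Z) Z≢Y
    ... | no  _   = flipped H
    same′ : ∀ Q X → Z ≢ X → ∀ H → (𝒲 [ Y ≔ Q ]) X H ≡ (𝒱 [ Y ≔ Q ]) X H
    same′ Q X Z≢X H with Y ≟ⱽ X
    ... | yes _ = refl
    ... | no  _ = same X Z≢X H

  -- Refutations

  -- Branching over `𝔖` gives a common bound to any family of stages, one for each process, which is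
  -- what the closure argument for ν asks for.
  data Stage : Set where
    bottom : Stage
    sup    : (𝔖 → Stage) → Stage

  data _≺_ : Rel Stage 0ℓ where
    child : ∀ {f} H → f H ≺ sup f

  ≺-wellFounded : WellFounded _≺_
  ≺-wellFounded α = acc (below α)
    where
    below : ∀ α {β} → β ≺ α → Acc _≺_ β
    below (sup f) (child H) = acc (below (f H))

  -- The iterates of `F` from the empty set, with a union over the children at each `sup`.
  approximant : (Pred 𝔖 0ℓ → Pred 𝔖 0ℓ) → Stage → Pred 𝔖 0ℓ
  approximant F bottom  _ = ⊥
  approximant F (sup f) H = ∃[ H′ ] F (approximant F (f H′)) H

  -- Adam sees a μ as a greatest fixpoint of the dual operator F, certified by
  -- a post-fixed point, and a ν as a least one, certified by an approximant.
  Certificate : Fixpoint → (Pred 𝔖 0ℓ → Pred 𝔖 0ℓ) → Set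
  Certificate μ F = Σ[ Q ∈ Subset 𝔖 ] (∀ {H} → H ∈ Q → F (_∈ Q) H)
  Certificate ν F = Stage

  certified : ∀ η F → Certificate η F → Pred 𝔖 0ℓ
  certified μ F (Q , _) = _∈ Q
  certified ν F α       = approximant F α

  stage : ∀ η F → Certificate η F → Stage
  -- Only a ν has to lower its stage; a μ carries a default.
  stage μ F _ = bottom
  stage ν F α = α

  -- A post-fixed point certifies its own unfolding. Membership in an approximant rules out `bottom`
  -- and names a child of `sup f` whose approximant `F` was applied to.
  unfold-certificate : ∀ η F k {H} → certified η F k H →
    Σ[ k′ ∈ Certificate η F ]
      F (certified η F k′) H × (η ≡ ν → stage η F k′ ≺ stage η F k)
  unfold-certificate μ F (Q , post) h        = (Q , post) , post h , λ ()
  unfold-certificate ν F (sup f)    (H′ , h) = f H′ , h , λ _ → child H′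

  Environment : Set₁
  Environment = Var → Pred 𝔖 0ℓ

  -- The comparison is oriented as in `binderOf`, so that one case split settles both the value and
  -- the binder of a variable.
  _[_↦_] : Environment → Var → Pred 𝔖 0ℓ → Environment
  (ρ [ Z ↦ P ]) Y = if does (Y ≟ⱽ Z) then P else ρ Y

  -- The dual semantics with evidence: a refutation contains Adam's choices at conjunctions and
  -- boxes and a certificate at each fixpoint. The environment gives the processes outside the value
  -- of each variable.
  Refutes : PNF → Environment → Pred 𝔖 0ℓ
  Refutes (pos Z)     ρ H = ρ Z H
  Refutes (neg Z)     ρ H = ¬ ρ Z H
  Refutes (φ ∧ ψ)     ρ H = Refutes φ ρ H ⊎ Refutes ψ ρ H
  Refutes (φ ∨ ψ)     ρ H = Refutes φ ρ H × Refutes ψ ρ H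
  Refutes (⟨ m ⟩ φ)   ρ H = ∀ {H′} → H —[ m ]→ H′ → Refutes φ ρ H′
  Refutes ([ m ] φ)   ρ H = ∃[ H′ ] (H —[ m ]→ H′) × Refutes φ ρ H′
  Refutes (fix η Z φ) ρ H =
    Σ[ k ∈ Certificate η (λ P → Refutes φ (ρ [ Z ↦ P ])) ]
      certified η (λ P → Refutes φ (ρ [ Z ↦ P ])) k H

  Complements : Environment → Valuation → Set
  Complements ρ 𝒱 = ∀ Z {H} → (ρ Z H → H ∉ 𝒱 Z) × (H ∉ 𝒱 Z → ρ Z H)

  complements-update : ∀ {ρ 𝒱 P Q} Z → Complements ρ 𝒱 →
    (∀ {H} → (P H → H ∉ Q) × (H ∉ Q → P H)) →
    Complements (ρ [ Z ↦ P ]) (𝒱 [ Z ≔ Q ])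
  complements-update Z ρ∁𝒱 P∁Q Y with Y ≟ⱽ Z | Z ≟ⱽ Y
  ... | yes _    | yes _   = P∁Q
  ... | yes refl | no  Z≢Z = contradiction refl Z≢Z
  ... | no  Y≢Z  | yes Z≡Y = contradiction (sym Z≡Y) Y≢Z
  ... | no  _    | no  _   = ρ∁𝒱 Y

  refute : ∀ φ {𝒱 ρ H} → Complements ρ 𝒱 → H ∉ ⟦ ⌜ φ ⌝ ⟧ 𝒱 → Refutes φ ρ H
  refute (pos Z) ρ∁𝒱 h = proj₂ (ρ∁𝒱 Z) h
  refute (neg Z) ρ∁𝒱 h = λ r → h (not⁺ (proj₁ (ρ∁𝒱 Z) r))
  refute (φ ∧ ψ) {𝒱} {H = H} ρ∁𝒱 h with T? (⟦ ⌜ φ ⌝ ⟧ 𝒱 H)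
  ... | yes p = inj₂ (refute ψ ρ∁𝒱 λ q → h (Equivalence.from T-∧ (p , q)))
  ... | no ¬p = inj₁ (refute φ ρ∁𝒱 ¬p)
  refute (φ ∨ ψ) ρ∁𝒱 h =
    let ¬φ , ¬ψ = Equivalence.to T-∧ (decidable-stable (T? _) (h ∘ not⁺))
    in refute φ ρ∁𝒱 (not⁻ ¬φ) , refute ψ ρ∁𝒱 (not⁻ ¬ψ)
  refute (⟨ m ⟩ φ) ρ∁𝒱 h mv = refute φ ρ∁𝒱 λ p → h (em⁺ (_ , mv , p))
  refute ([ m ] φ) ρ∁𝒱 h =
    let H′ , mv , p = em⁻ (decidable-stable (T? _) (h ∘ not⁺))
    in H′ , mv , refute φ ρ∁𝒱 (not⁻ p)
  -- A process outside the least fixpoint is outside some pre-fixed point, and the complement of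
  -- that set is a post-fixed point of the dual operator.
  refute (fix μ Z φ) {𝒱} {ρ} {H} ρ∁𝒱 h =
    (not ∘ Q , λ {H′} H′∈ → refute φ (complements-update Z ρ∁𝒱 (not⁻ , not⁺))
                              (λ p → not⁻ H′∈ (closed p))) , not⁺ H∉Q
    where
    Separates : Pred (Subset 𝔖) 0ℓ
    Separates Q = (⟦ ⌜ φ ⌝ ⟧ (𝒱 [ Z ≔ Q ]) ⊆ Q) × H ∉ Q
    separated : ∃ Separates
    separated = decidable-stable (em {∃ Separates}) λ none → h
      (em⁺ {∀ Q → ⟦ ⌜ φ ⌝ ⟧ (𝒱 [ Z ≔ Q ]) ⊆ Q → H ∈ Q} λ Q closed →
         decidable-stable (T? _) λ H∉Q → none (Q , closed , H∉Q))
    Q      = proj₁ separated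
    closed = λ {H′} → proj₁ (proj₂ separated) {H′}
    H∉Q    = proj₂ (proj₂ separated)
  -- Here `H` lies in every pre-fixed point of the negated body, in particular in `⟪ Ranked ⟫`, the
  -- processes reached by applying `F` to some approximant.
  refute (fix ν Z φ) {𝒱} {ρ} {H} ρ∁𝒱 h =
    let α , r = em⁻ (em⁻ (decidable-stable (T? _) (h ∘ not⁺)) ⟪ Ranked ⟫ closed)
    -- The constant family makes `F` of the approximant at `α` an approximant itself; any index
    -- would serve in place of `H`.
    in sup (λ _ → α) , H , r
    where
    F : Pred 𝔖 0ℓ → Pred 𝔖 0ℓ
    F P = Refutes φ (ρ [ Z ↦ P ])
    Ranked : Pred 𝔖 0ℓ
    Ranked H = ∃[ α ] F (approximant F α) H
    rank : 𝔖 → Stage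
    rank H with em {Ranked H}
    ... | yes (α , _) = α
    ... | no  _       = bottom
    ranked : ∀ {H} → Ranked H → F (approximant F (rank H)) H
    ranked {H} r with em {Ranked H}
    ... | yes (_ , r′) = r′
    ... | no  ¬r       = contradiction r ¬r
    -- As `sup rank` collects a stage for every ranked process, its approximant is all of `Ranked`;
    -- so `F` applied to `Ranked` yields only ranked processes.
    supremum : ∀ {H} → (approximant F (sup rank) H → H ∉ not ∘ ⟪ Ranked ⟫) ×
                       (H ∉ not ∘ ⟪ Ranked ⟫ → approximant F (sup rank) H)
    supremum {H} =
      (λ (_ , r) H∉ → not⁻ H∉ (em⁺ (_ , r))) ,
      (λ H∈ → H , ranked (em⁻ (decidable-stable (T? _) (H∈ ∘ not⁺))))
    flipped : ∀ Q H → (𝒱 [ Z ≔ not ∘ Q ]) Z H ≡ not ((𝒱 [ Z ≔ Q ]) Z H)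
    flipped Q H with Z ≟ⱽ Z
    ... | yes _   = refl
    ... | no  Z≢Z = contradiction refl Z≢Z
    same : ∀ Q Y → Z ≢ Y → ∀ H → (𝒱 [ Z ≔ not ∘ Q ]) Y H ≡ (𝒱 [ Z ≔ Q ]) Y H
    same Q Y Z≢Y H with Z ≟ⱽ Y
    ... | yes Z≡Y = contradiction Z≡Y Z≢Y
    ... | no  _   = refl
    closed : ⟦ ∼ (⌜ φ ⌝ [¬ Z ]) ⟧ (𝒱 [ Z ≔ ⟪ Ranked ⟫ ]) ⊆ ⟪ Ranked ⟫
    closed {H′} ¬φ = em⁺ (sup rank ,
      refute φ (complements-update Z ρ∁𝒱 supremum) λ p →
        not⁻ ¬φ (subst True
          (sym (⟦[¬]⟧ Z ⌜ φ ⌝ (flipped ⟪ Ranked ⟫) (same ⟪ Ranked ⟫) H′)) p))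

  update-same : ∀ {ρ Z P} → (ρ [ Z ↦ P ]) Z ≡ P
  update-same {Z = Z} with Z ≟ⱽ Z
  ... | yes _   = refl
  ... | no  Z≢Z = contradiction refl Z≢Z

  -- Occurrences and their binders

  -- Keeps kind and scope beside each bound name, so that distinctness of names determines the whole
  -- fixpoint formula.
  fixes : PNF → List (Fixpoint × Var × PNF)
  fixes (pos Z)     = []
  fixes (neg Z)     = []
  fixes (φ ∧ ψ)     = fixes φ ++ fixes ψ
  fixes (φ ∨ ψ)     = fixes φ ++ fixes ψ
  fixes (⟨ m ⟩ φ)   = fixes φ
  fixes ([ m ] φ)   = fixes φ
  fixes (fix η Z φ) = (η , Z , φ) ∷ fixes φ

  boundName : Fixpoint × Var × PNF → Var
  boundName (_ , Z , _) = Z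

  binders-fixes : ∀ φ → binders φ ≡ map boundName (fixes φ)
  binders-fixes (pos Z)     = refl
  binders-fixes (neg Z)     = refl
  binders-fixes (φ ∧ ψ)     =
    trans (cong₂ _++_ (binders-fixes φ) (binders-fixes ψ))
          (sym (map-++ boundName (fixes φ) (fixes ψ)))
  binders-fixes (φ ∨ ψ)     =
    trans (cong₂ _++_ (binders-fixes φ) (binders-fixes ψ))
          (sym (map-++ boundName (fixes φ) (fixes ψ)))
  binders-fixes (⟨ m ⟩ φ)   = binders-fixes φ
  binders-fixes ([ m ] φ)   = binders-fixes φ
  binders-fixes (fix η Z φ) = cong (Z ∷_) (binders-fixes φ)

  fixes-∈Sub : ∀ {φ ψ f} → ψ ∈Sub φ → f ∈ˡ fixes ψ → f ∈ˡ fixes φ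
  fixes-∈Sub root              f∈ = f∈
  fixes-∈Sub (∧₀ o)            f∈ = fixes-∈Sub o (∈-++⁺ˡ f∈)
  fixes-∈Sub (∧₁ {ψ₀ = ψ} o)   f∈ = fixes-∈Sub o (∈-++⁺ʳ (fixes ψ) f∈)
  fixes-∈Sub (∨₀ o)            f∈ = fixes-∈Sub o (∈-++⁺ˡ f∈)
  fixes-∈Sub (∨₁ {ψ₀ = ψ} o)   f∈ = fixes-∈Sub o (∈-++⁺ʳ (fixes ψ) f∈)
  fixes-∈Sub (under⟨⟩ o)       f∈ = fixes-∈Sub o f∈
  fixes-∈Sub (under[] o)       f∈ = fixes-∈Sub o f∈
  fixes-∈Sub (body-of o)       f∈ = fixes-∈Sub o (there f∈)

  binder-unique : ∀ {φ η θ Z ψ χ} → Unique (binders φ) →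
    fix η Z ψ ∈Sub φ → fix θ Z χ ∈Sub φ → fix η Z ψ ≡ fix θ Z χ
  binder-unique {φ} unique o o′ =
    cong (λ (η , Z , ψ) → fix η Z ψ)
      (unique-map⇒injective boundName (subst Unique (binders-fixes φ) unique)
        (fixes-∈Sub o (here refl)) (fixes-∈Sub o′ (here refl)) refl)

  binderOf-name : ∀ {φ ψ Z b} (o : ψ ∈Sub φ) → binderOf Z o ≡ just b → Binder.name b ≡ Z
  binderOf-name (∧₀ o)      eq = binderOf-name o eq
  binderOf-name (∧₁ o)      eq = binderOf-name o eq
  binderOf-name (∨₀ o)      eq = binderOf-name o eq
  binderOf-name (∨₁ o)      eq = binderOf-name o eq
  binderOf-name (under⟨⟩ o) eq = binderOf-name o eq
  binderOf-name (under[] o) eq = binderOf-name o eq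
  binderOf-name {Z = Z} (variable-of {Z = Y} o) eq with Z ≟ⱽ Y
  binderOf-name (variable-of o) refl | yes Z≡Y = sym Z≡Y
  binderOf-name (variable-of o) eq   | no  _   = binderOf-name o eq
  binderOf-name {Z = Z} (body-of {Z = Y} o) eq with Z ≟ⱽ Y
  binderOf-name (body-of o) refl | yes Z≡Y = sym Z≡Y
  binderOf-name (body-of o) eq   | no  _   = binderOf-name o eq

  bindsPositively-∈Sub : ∀ {φ ψ} → BindsPositively φ → ψ ∈Sub φ → BindsPositively ψ
  bindsPositively-∈Sub bp root            = bp
  bindsPositively-∈Sub bp (∧₀ o)          = proj₁ (bindsPositively-∈Sub bp o)
  bindsPositively-∈Sub bp (∧₁ o)          = proj₂ (bindsPositively-∈Sub bp o)
  bindsPositively-∈Sub bp (∨₀ o)          = proj₁ (bindsPositively-∈Sub bp o)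
  bindsPositively-∈Sub bp (∨₁ o)          = proj₂ (bindsPositively-∈Sub bp o)
  bindsPositively-∈Sub bp (under⟨⟩ o)     = bindsPositively-∈Sub bp o
  bindsPositively-∈Sub bp (under[] o)     = bindsPositively-∈Sub bp o
  bindsPositively-∈Sub bp (variable-of o) = tt
  bindsPositively-∈Sub bp (body-of o)     = proj₂ (bindsPositively-∈Sub bp o)

  -- Rules out that a play stops at a negated literal whose variable is bound.
  bound⇒positive : ∀ {φ ψ Z b} → BindsPositively φ → (o : ψ ∈Sub φ) →
    binderOf Z o ≡ just b → Positive Z ψ
  bound⇒positive bp (∧₀ o)          eq = proj₁ (bound⇒positive bp o eq)
  bound⇒positive bp (∧₁ o)          eq = proj₂ (bound⇒positive bp o eq)
  bound⇒positive bp (∨₀ o)          eq = proj₁ (bound⇒positive bp o eq)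
  bound⇒positive bp (∨₁ o)          eq = proj₂ (bound⇒positive bp o eq)
  bound⇒positive bp (under⟨⟩ o)     eq = bound⇒positive bp o eq
  bound⇒positive bp (under[] o)     eq = bound⇒positive bp o eq
  bound⇒positive bp (variable-of o) eq = tt
  bound⇒positive {Z = Z} bp (body-of {Z = Y} o) eq with Z ≟ⱽ Y
  ... | yes refl = proj₁ (bindsPositively-∈Sub bp o)
  ... | no  Z≢Y  = bound⇒positive bp o eq Z≢Y

  -- The variable of a fixpoint is placed below its body: then entering a
  -- fixpoint goes down and every unfolding goes (weakly) up.
  depth : ∀ {φ ψ} → ψ ∈Sub φ → ℕ
  depth root            = 0
  depth (∧₀ o)          = 1 + depth o
  depth (∧₁ o)          = 1 + depth o
  depth (∨₀ o)          = 1 + depth o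
  depth (∨₁ o)          = 1 + depth o
  depth (under⟨⟩ o)     = 1 + depth o
  depth (under[] o)     = 1 + depth o
  depth (body-of o)     = 1 + depth o
  depth (variable-of o) = 2 + depth o

  -- Chosen so that `depth o + height ψ` never grows on the way down; a fixpoint counts 2 because
  -- its variable lies two levels below it.
  height : PNF → ℕ
  height (pos Z)     = 0
  height (neg Z)     = 0
  height (φ ∧ ψ)     = 1 + (height φ + height ψ)
  height (φ ∨ ψ)     = 1 + (height φ + height ψ)
  height (⟨ m ⟩ φ)   = 1 + height φ
  height ([ m ] φ)   = 1 + height φ
  height (fix η Z φ) = 2 + height φ

  depth+height≤ : ∀ {φ ψ} (o : ψ ∈Sub φ) → depth o + height ψ ≤ height φ
  depth+height≤ root            = ≤-refl
  depth+height≤ (∧₀ o)          = <-+-≤ (depth o) (s≤s (m≤m+n _ _)) (depth+height≤ o)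
  depth+height≤ (∧₁ o)          = <-+-≤ (depth o) (s≤s (m≤n+m _ _)) (depth+height≤ o)
  depth+height≤ (∨₀ o)          = <-+-≤ (depth o) (s≤s (m≤m+n _ _)) (depth+height≤ o)
  depth+height≤ (∨₁ o)          = <-+-≤ (depth o) (s≤s (m≤n+m _ _)) (depth+height≤ o)
  depth+height≤ (under⟨⟩ o)     = <-+-≤ (depth o) ≤-refl (depth+height≤ o)
  depth+height≤ (under[] o)     = <-+-≤ (depth o) ≤-refl (depth+height≤ o)
  depth+height≤ (body-of o)     = <-+-≤ (depth o) (s≤s (n≤1+n _)) (depth+height≤ o)
  depth+height≤ (variable-of o) =
    <-+-≤ (suc (depth o)) {b = 1} ≤-refl
      (<-+-≤ (depth o) (s≤s (s≤s z≤n)) (depth+height≤ o))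

  depth≤height : ∀ {φ ψ} (o : ψ ∈Sub φ) → depth o ≤ height φ
  depth≤height o = ≤-trans (m≤m+n _ _) (depth+height≤ o)

  -- Signatures: certificates for the binders around an occurrence

  module Signatures (𝒱 : Valuation) {φ : PNF} where

    -- The certificate of an inner fixpoint is about an operator that depends on the certificates
    -- around it, hence the mutual definition.
    Signature : ∀ {ψ} → ψ ∈Sub φ → Set
    environment : ∀ {ψ} (o : ψ ∈Sub φ) → Signature o → Environment
    operator : ∀ {η Z ψ} (o : fix η Z ψ ∈Sub φ) → Signature o → Pred 𝔖 0ℓ → Pred 𝔖 0ℓ

    Signature root                = ⊤
    Signature (∧₀ o)              = Signature o
    Signature (∧₁ o)              = Signature o
    Signature (∨₀ o)              = Signature o
    Signature (∨₁ o)              = Signature o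
    Signature (under⟨⟩ o)         = Signature o
    Signature (under[] o)         = Signature o
    Signature (variable-of {η = η} o) = Σ[ e ∈ Signature o ] Certificate η (operator o e)
    Signature (body-of {η = η} o) = Σ[ e ∈ Signature o ] Certificate η (operator o e)

    environment root        _ = λ Z → _∉ 𝒱 Z
    environment (∧₀ o)      e = environment o e
    environment (∧₁ o)      e = environment o e
    environment (∨₀ o)      e = environment o e
    environment (∨₁ o)      e = environment o e
    environment (under⟨⟩ o) e = environment o e
    environment (under[] o) e = environment o e
    environment (variable-of {η = η} {Z} o) (e , k) =
      environment o e [ Z ↦ certified η (operator o e) k ]
    environment (body-of {η = η} {Z} o) (e , k) =
      environment o e [ Z ↦ certified η (operator o e) k ]

    operator {Z = Z} {ψ} o e P = Refutes ψ (environment o e [ Z ↦ P ])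

    -- Frames are indexed by the depth of the body of their binder.
    frame : ∀ {ψ} (o : ψ ∈Sub φ) → Signature o → ℕ → Maybe (Binder φ × Stage)
    frame root        _ = λ _ → nothing
    frame (∧₀ o)      e = frame o e
    frame (∧₁ o)      e = frame o e
    frame (∨₀ o)      e = frame o e
    frame (∨₁ o)      e = frame o e
    frame (under⟨⟩ o) e = frame o e
    frame (under[] o) e = frame o e
    frame (variable-of {η = η} o) (e , k) =
      push (suc (depth o)) (binder o , stage η (operator o e) k) (frame o e)
    frame (body-of {η = η} o) (e , k) =
      push (suc (depth o)) (binder o , stage η (operator o e) k) (frame o e)

    environment-free : ∀ {ψ Z} (o : ψ ∈Sub φ) e → binderOf Z o ≡ nothing →
      environment o e Z ≡ (_∉ 𝒱 Z)
    environment-free root        e eq = refl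
    environment-free (∧₀ o)      e eq = environment-free o e eq
    environment-free (∧₁ o)      e eq = environment-free o e eq
    environment-free (∨₀ o)      e eq = environment-free o e eq
    environment-free (∨₁ o)      e eq = environment-free o e eq
    environment-free (under⟨⟩ o) e eq = environment-free o e eq
    environment-free (under[] o) e eq = environment-free o e eq
    environment-free {Z = Z} (variable-of {Z = Y} o) (e , _) eq with Z ≟ⱽ Y
    ... | no _ = environment-free o e eq
    environment-free {Z = Z} (body-of {Z = Y} o) (e , _) eq with Z ≟ⱽ Y
    ... | no _ = environment-free o e eq

    -- Frames hold only enclosing binders; this gives the subformula relation in which "outermost"
    -- is expressed.
    frame-∈Sub : ∀ {ψ} (o : ψ ∈Sub φ) e {d b α} → frame o e d ≡ just (b , α) →
      ψ ∈Sub fix (Binder.kind b) (Binder.name b) (Binder.scope b)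
    frame-∈Sub (∧₀ o)      e eq = ∧₀ (frame-∈Sub o e eq)
    frame-∈Sub (∧₁ o)      e eq = ∧₁ (frame-∈Sub o e eq)
    frame-∈Sub (∨₀ o)      e eq = ∨₀ (frame-∈Sub o e eq)
    frame-∈Sub (∨₁ o)      e eq = ∨₁ (frame-∈Sub o e eq)
    frame-∈Sub (under⟨⟩ o) e eq = under⟨⟩ (frame-∈Sub o e eq)
    frame-∈Sub (under[] o) e eq = under[] (frame-∈Sub o e eq)
    frame-∈Sub (variable-of o) (e , k) eq with push⁻ (suc (depth o)) _ (frame o e) eq
    ... | inj₁ refl = variable-of root
    ... | inj₂ eq′  = variable-of (frame-∈Sub o e eq′)
    frame-∈Sub (body-of o) (e , k) eq with push⁻ (suc (depth o)) _ (frame o e) eq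
    ... | inj₁ refl = body-of root
    ... | inj₂ eq′  = body-of (frame-∈Sub o e eq′)

    frame-binder-∈Sub : ∀ {η Z ψ} (o : fix η Z ψ ∈Sub φ) e {d b α} →
      frame (body-of o) e d ≡ just (b , α) →
      fix η Z ψ ∈Sub fix (Binder.kind b) (Binder.name b) (Binder.scope b)
    frame-binder-∈Sub o (e , k) eq with push⁻ (suc (depth o)) _ (frame o e) eq
    ... | inj₁ refl = root
    ... | inj₂ eq′  = frame-∈Sub o e eq′

    frame-below : ∀ {η Z ψ} (o : fix η Z ψ ∈Sub φ) e {d} → d ≤ depth o →
      frame (body-of o) e d ≡ frame o (proj₁ e) d
    frame-below o (e , k) d≤ = push-below _ (frame o e) (s≤s d≤)

    frame-top : ∀ {η Z ψ} (o : fix η Z ψ ∈Sub φ) e →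
      frame (body-of o) e (depth (body-of o)) ≡
        just (binder o , stage η (operator o (proj₁ e)) (proj₂ e))
    frame-top o (e , k) = push-top (suc (depth o)) _ (frame o e)

    binderStage : (b : Binder φ) → Signature (body-of (Binder.at b)) → Stage
    binderStage b (e , k) = stage (Binder.kind b) (operator (Binder.at b) e) k

    -- Unfolding discards the frames inside `b`, lowers the stage of `b` if it is a ν, and keeps all
    -- frames outside `b`, which sit at depths below that of its body.
    record Unfolding {ψ} (o : ψ ∈Sub φ) (e : Signature o) (b : Binder φ) (H : 𝔖) : Set where
      field
        target  : Signature (body-of (Binder.at b))
        refuted : Refutes (Binder.scope b) (environment (body-of (Binder.at b)) target) H
        upwards : depth (body-of (Binder.at b)) ≤ depth o
        kept    : ∀ {d} → d ≤ depth (Binder.at b) →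
                  frame (body-of (Binder.at b)) target d ≡ frame o e d
        old     : Stage
        found   : frame o e (depth (body-of (Binder.at b))) ≡ just (b , old)
        lowered : Binder.kind b ≡ ν → binderStage b target ≺ old

    unfold-innermost : ∀ {η Z ψ H} (o : fix η Z ψ ∈Sub φ) (e : Signature (body-of o)) →
      certified η (operator o (proj₁ e)) (proj₂ e) H → Unfolding (body-of o) e (binder o) H
    unfold-innermost {η} o (e , k) h with unfold-certificate η (operator o e) k h
    ... | k′ , r , lower = record
      { target  = e , k′
      ; refuted = r
      ; upwards = ≤-refl
      ; kept    = λ d≤ → trans (frame-below o _ d≤) (sym (frame-below o _ d≤))
      ; old     = stage η (operator o e) k
      ; found   = frame-top o (e , k)
      ; lowered = lower
      }

    -- An unfolding at `o` concerns only frames up to `depth o`, and these are the same at the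
    -- deeper `o′`.
    unfold-outer : ∀ {ψ χ b H} {o : ψ ∈Sub φ} {o′ : χ ∈Sub φ} {e e′} →
      depth o ≤ depth o′ → (∀ {d} → d ≤ depth o → frame o′ e′ d ≡ frame o e d) →
      Unfolding o e b H → Unfolding o′ e′ b H
    unfold-outer o≤o′ same u = record
      { target  = target
      ; refuted = refuted
      ; upwards = ≤-trans upwards o≤o′
      ; kept    = λ d≤ → trans (kept d≤) (sym (same (≤-trans d≤ (<⇒≤ upwards))))
      ; old     = old
      ; found   = trans (same upwards) found
      ; lowered = lowered
      }
      where open Unfolding u

    -- Recursion outwards along the occurrence, in step with `binderOf`, until the binder of `Z` is
    -- met.
    unfold-bound : ∀ {ψ Z b H} (o : ψ ∈Sub φ) e → binderOf Z o ≡ just b →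
      environment o e Z H → Unfolding o e b H
    unfold-bound (∧₀ o)      e eq h = unfold-outer (n≤1+n _) (λ _ → refl) (unfold-bound o e eq h)
    unfold-bound (∧₁ o)      e eq h = unfold-outer (n≤1+n _) (λ _ → refl) (unfold-bound o e eq h)
    unfold-bound (∨₀ o)      e eq h = unfold-outer (n≤1+n _) (λ _ → refl) (unfold-bound o e eq h)
    unfold-bound (∨₁ o)      e eq h = unfold-outer (n≤1+n _) (λ _ → refl) (unfold-bound o e eq h)
    unfold-bound (under⟨⟩ o) e eq h = unfold-outer (n≤1+n _) (λ _ → refl) (unfold-bound o e eq h)
    unfold-bound (under[] o) e eq h = unfold-outer (n≤1+n _) (λ _ → refl) (unfold-bound o e eq h)
    unfold-bound {Z = Z} (variable-of {Z = Y} o) e eq h with Z ≟ⱽ Y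
    unfold-bound (variable-of o) e refl h | yes _ =
      unfold-outer (n≤1+n _) (λ _ → refl) (unfold-innermost o e h)
    unfold-bound (variable-of o) e eq   h | no  _ =
      unfold-outer (m≤n+m _ 2) (frame-below o e) (unfold-bound o (proj₁ e) eq h)
    unfold-bound {Z = Z} (body-of {Z = Y} o) e eq h with Z ≟ⱽ Y
    unfold-bound (body-of o) e refl h | yes _ = unfold-innermost o e h
    unfold-bound (body-of o) e eq   h | no  _ =
      unfold-outer (n≤1+n _) (frame-below o e) (unfold-bound o (proj₁ e) eq h)

  -- Adam's invariant and the strategy that preserves it

  module WinningStrategy (𝒱 : Valuation) (H₀ : 𝔖) (φ : PNF)
                         (bindsPos : BindsPositively φ) (unique : Unique (binders φ))
                         (refuted₀ : Refutes φ (λ Z → _∉ 𝒱 Z) H₀) where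

    open Game 𝒱 H₀ φ
    open Signatures 𝒱 {φ}

    record State (C : Config) : Set where
      constructor state
      field
        signature : Signature (occurrence C)
        refuted   : Refutes (formula C) (environment (occurrence C) signature) (process C)

    open State

    depthᶜ : Config → ℕ
    depthᶜ C = depth (occurrence C)

    frameˢ : ∀ {C} → State C → ℕ → Maybe (Binder φ × Stage)
    frameˢ {C} x = frame (occurrence C) (signature x)

    -- Every move other than an unfolding goes strictly deeper, so a move to the same or a smaller
    -- depth must be a `jump`.
    data Progress : ∀ {C C′} → State C → State C′ → Set where
      descend : ∀ {C C′} {x : State C} {y : State C′} → depthᶜ C < depthᶜ C′ →
                (∀ {d} → d ≤ depthᶜ C → frameˢ y d ≡ frameˢ x d) → Progress x y
      jump : ∀ {H Z b} {o : pos Z ∈Sub φ} {x : State (H ⊢ o)} → Binder.name b ≡ Z →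
             (u : Unfolding o (signature x) b H) →
             Progress x (state {H ⊢ body-of (Binder.at b)} (Unfolding.target u) (Unfolding.refuted u))

    Continues : ∀ {C} → State C → Config → Set
    Continues x C′ = Σ[ y ∈ State C′ ] Progress x y

    -- Adam's choice is read off the refutation.
    reply : ∀ {C} → AdamChooses C → (x : State C) → ∃[ C′ ] (C ⟶ C′) × Continues x C′
    reply at-∧ (state e (inj₁ r)) = _ , and₀ , state e r , descend ≤-refl λ _ → refl
    reply at-∧ (state e (inj₂ r)) = _ , and₁ , state e r , descend ≤-refl λ _ → refl
    reply at-□ (state e (H′ , mv , r)) = _ , box mv , state e r , descend ≤-refl λ _ → refl

    continue : ∀ {C C′} → ¬ AdamChooses C → (x : State C) → C ⟶ C′ → Continues x C′
    continue ¬adam (state e (k , h)) (enter {H = H} {o = o}) =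
      -- The certificate passes from the refutation into the signature, where looking up the
      -- variable returns it.
      state (e , k) (subst (λ P → P H) (sym (update-same {environment o e})) h) ,
      descend (m≤n+m _ 1) (frame-below o (e , k))
    continue ¬adam x (unfold {o = o} eq) =
      let u = unfold-bound o (signature x) eq (refuted x)
      in _ , jump (binderOf-name o eq) u
    continue ¬adam (state e (r₀ , r₁)) or₀ = state e r₀ , descend ≤-refl λ _ → refl
    continue ¬adam (state e (r₀ , r₁)) or₁ = state e r₁ , descend ≤-refl λ _ → refl
    continue ¬adam (state e r) (dia mv) = state e (r mv) , descend ≤-refl λ _ → refl
    continue ¬adam x and₀    = contradiction at-∧ ¬adam
    continue ¬adam x and₁    = contradiction at-∧ ¬adam
    continue ¬adam x (box _) = contradiction at-□ ¬adam

    -- A bound variable could be unfolded, so a stuck one is free and refuted by the complement of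
    -- `𝒱`; a stuck box or conjunction would contradict the choice held by its refutation.
    adam-wins-stuck : ∀ {C} → State C → Stuck C → AdamWinsAt (process C) (formula C)
    adam-wins-stuck {_⊢_ H {pos Z} o} (state e r) stuck with binderOf Z o in eq
    ... | just b  = contradiction (unfold eq) stuck
    ... | nothing = subst (λ P → P H) (environment-free o e eq) r
    adam-wins-stuck {_⊢_ H {neg Z} o} (state e r) stuck with binderOf Z o in eq
    ... | just b  = contradiction refl (bound⇒positive bindsPos o eq)
    ... | nothing = decidable-stable (T? _)
                      (subst (λ P → ¬ P H) (environment-free o e eq) r)
    adam-wins-stuck {_⊢_ H {ψ₀ ∧ ψ₁} o} x stuck = stuck (proj₁ (proj₂ (reply at-∧ x)))
    adam-wins-stuck {_⊢_ H {ψ₀ ∨ ψ₁} o} x stuck = stuck or₀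
    adam-wins-stuck {_⊢_ H {⟨ m ⟩ ψ} o} x stuck = tt
    adam-wins-stuck {_⊢_ H {[ m ] ψ} o} x stuck = stuck (proj₁ (proj₂ (reply at-□ x)))
    adam-wins-stuck {_⊢_ H {fix η Z ψ} o} x stuck = stuck enter

    -- A strategy sees only configurations, so the states are recovered from the
    -- history; em makes the choices, as it decides Σ-types by giving witnesses.

    follow : ∀ {C} → Maybe (State C) → ∀ C′ → Maybe (State C′)
    follow nothing  C′ = nothing
    follow (just x) C′ with em {Continues x C′}
    ... | yes (y , _) = just y
    ... | no  _       = nothing

    follow-defined : ∀ {C C′} {x : State C} → Continues x C′ →
      ∃[ y ] follow (just x) C′ ≡ just y
    follow-defined {C′ = C′} {x} more with em {Continues x C′}
    ... | yes (y , _) = y , refl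
    ... | no  ¬more   = contradiction more ¬more

    -- Whichever successor state `em` returns, it comes with its own progress.
    follow-progress : ∀ {C C′} {x : State C} {y : State C′} →
      follow (just x) C′ ≡ just y → Progress x y
    follow-progress {C′ = C′} {x} eq with em {Continues x C′}
    follow-progress refl | yes (_ , p) = p

    track : List Config → ∀ C → Maybe (State C)
    track [] C with em {initial ≡ C}
    ... | yes refl = just (state tt refuted₀)
    ... | no  _    = nothing
    track (B ∷ h) C = follow (track h B) C

    track-start : ∃[ x ] track [] initial ≡ just x
    track-start with em {initial ≡ initial}
    ... | yes refl = _ , refl
    ... | no  ¬eq  = contradiction refl ¬eq

    -- Legality is required after every history; where no state is tracked, any move is taken. `C`
    -- itself is the default when it is not Adam's turn or no move exists.
    respond : ∀ C → Maybe (State C) → Config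
    respond C (just x) with em {AdamChooses C}
    ... | yes adam = proj₁ (reply adam x)
    ... | no  _    = C
    respond C nothing with em {∃[ C′ ] (C ⟶ C′)}
    ... | yes (C′ , _) = C′
    ... | no  _        = C

    respond-legal : ∀ {C C′} (s : Maybe (State C)) → AdamChooses C → C ⟶ C′ → C ⟶ respond C s
    respond-legal {C} (just x) adam mv with em {AdamChooses C}
    ... | yes adam′ = proj₁ (proj₂ (reply adam′ x))
    ... | no  ¬adam = contradiction adam ¬adam
    respond-legal {C} nothing adam mv with em {∃[ C′ ] (C ⟶ C′)}
    ... | yes (_ , mv′) = mv′
    ... | no  ¬mv       = contradiction (_ , mv) ¬mv

    respond-continues : ∀ {C} → AdamChooses C → (x : State C) → Continues x (respond C (just x))
    respond-continues {C} adam x with em {AdamChooses C}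
    ... | yes adam′ = proj₂ (proj₂ (reply adam′ x))
    ... | no  ¬adam = contradiction adam ¬adam

    strategy : Strategy
    strategy = record
      { choose = λ h C → respond C (track h C)
      ; legal  = λ {h} {C} → respond-legal (track h C)
      }

    -- At Adam's configurations the reply preserves the invariant, elsewhere every move does, so a
    -- state is never lost.
    tracked : ∀ {h C} (ρ : Run h C) → Respects strategy ρ → ∃[ x ] track h C ≡ just x
    tracked start _ = track-start
    tracked (step {h} {C} {C′} ρ mv) (respects , obeys) with tracked ρ respects
    ... | x , eq rewrite eq = follow-defined (next em)
      where
      next : Dec (AdamChooses C) → Continues x C′
      next (yes adam) = subst (Continues x) (sym (obeys adam)) (respond-continues adam x)
      next (no ¬adam) = continue ¬adam x mv

    -- Infinite plays: the frame at the least recurring depth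

    record Advances (C : Config) {C′ : Config} (y : State C′)
                    (d : ℕ) (b : Binder φ) (α : Stage) : Set where
      field
        next   : Stage
        framed : frameˢ y d ≡ just (b , next)
        weak   : Binder.kind b ≡ ν → next ≡ α ⊎ next ≺ α
        named  : depthᶜ C′ ≡ d → formula C ≡ pos (Binder.name b)
        strict : depthᶜ C′ ≡ d → Binder.kind b ≡ ν → next ≺ α

    -- While the play stays at depth `d` or deeper, the frame at `d` changes only when a move lands
    -- exactly there, and such a move unfolds its binder.
    advance : ∀ {C C′} {x : State C} {y : State C′} {d b α} → Progress x y →
      d ≤ depthᶜ C → d ≤ depthᶜ C′ → frameˢ x d ≡ just (b , α) → Advances C y d b α
    advance (descend C<C′ same) d≤C d≤C′ eq = record
      { framed = trans (same d≤C) eq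
      ; weak   = λ _ → inj₁ refl
      ; named  = λ C′≡d → contradiction C<C′ (C≮C′ C′≡d)
      ; strict = λ C′≡d → contradiction C<C′ (C≮C′ C′≡d)
      }
      where C≮C′ = λ C′≡d → ≤⇒≯ (subst (_≤ _) (sym C′≡d) d≤C)
    advance (jump {b = b} refl u) d≤C d≤C′ eq with m≤n⇒m<n∨m≡n d≤C′
    ... | inj₁ d<C′ = record
      { framed = trans (Unfolding.kept u (s≤s⁻¹ d<C′)) eq
      ; weak   = λ _ → inj₁ refl
      ; named  = λ C′≡d → contradiction (sym C′≡d) (<⇒≢ d<C′)
      ; strict = λ C′≡d → contradiction (sym C′≡d) (<⇒≢ d<C′)
      }
    -- The frame found by the unfolding and the given one sit at the same depth, so the unfolded
    -- binder is the given one.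
    ... | inj₂ refl with trans (sym (Unfolding.found u)) eq
    ... | refl = record
      { framed = frame-top (Binder.at b) (Unfolding.target u)
      ; weak   = λ isν → inj₂ (Unfolding.lowered u isν)
      ; named  = λ _ → refl
      ; strict = λ _ → Unfolding.lowered u
      }

    landing : ∀ {C C′} {x : State C} {y : State C′} → Progress x y → depthᶜ C′ ≤ depthᶜ C →
      ∃[ b ] ∃[ α ] frameˢ y (depthᶜ C′) ≡ just (b , α)
    landing (descend C<C′ _)   C′≤C = contradiction C<C′ (≤⇒≯ C′≤C)
    landing (jump {b = b} _ u) _    = b , _ , frame-top (Binder.at b) (Unfolding.target u)

    -- Unfolding `Y` leads to the body of its binder, whose frames hold only that binder and those
    -- around it; distinct names identify it with the given fixpoint.
    enclosed : ∀ {C C′ Y θ χ d b α} → C ⟶ C′ → formula C ≡ pos Y → (y : State C′) →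
      frameˢ y d ≡ just (b , α) → fix θ Y χ ∈Sub φ →
      fix θ Y χ ∈Sub fix (Binder.kind b) (Binder.name b) (Binder.scope b)
    enclosed {b = b} (unfold {o = o} {b = b′} eq) refl y frame≡ o′
      with refl ← binderOf-name o eq =
      subst (_∈Sub fix (Binder.kind b) (Binder.name b) (Binder.scope b))
        (binder-unique unique (Binder.at b′) o′)
        (frame-binder-∈Sub (Binder.at b′) (signature y) frame≡)

    last-move : ∀ {B h C} → Run (B ∷ h) C → B ⟶ C
    last-move (step _ mv) = mv

    module Infinite (π : ℕ → Config) (moves : ∀ n → π n ⟶ π (suc n))
                    (x : ∀ n → State (π n)) (progress : ∀ n → Progress (x n) (x (suc n))) where

      D : ℕ → ℕ
      D n = depthᶜ (π n)

      module _ (d N : ℕ) (above : ∀ {m} → N ≤ m → d ≤ D m)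
               (recurs : ∀ n → ∃[ m ] n ≤ m × D m ≡ d) where

        lands : ∀ n → ∃[ m ] n ≤ m × D (suc m) ≡ d
        -- Asking from `suc n` on makes the index a successor, so a move leads there.
        lands n with recurs (suc n)
        ... | suc m , s≤s n≤m , eq = m , n≤m , eq

        module _ (b : Binder φ) (start : ℕ) (N≤start : N ≤ start)
                 (α₀ : Stage) (framed₀ : frameˢ (x start) d ≡ just (b , α₀)) where

          -- From `start` on the play never rises above depth `d`, so the frame there keeps its
          -- binder; each frame provides the next advance and conversely.
          framed : ∀ j → ∃[ α ] frameˢ (x (j + start)) d ≡ just (b , α)
          advances : ∀ j → Advances (π (j + start)) (x (suc j + start)) d b (proj₁ (framed j))
          framed zero    = α₀ , framed₀
          framed (suc j) = Advances.next (advances j) , Advances.framed (advances j)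
          advances j =
            advance (progress (j + start)) (above (≤-trans N≤start (m≤n+m start j)))
              (above (≤-trans N≤start (m≤n+m start (suc j)))) (proj₂ (framed j))

          stages : ℕ → Stage
          stages j = proj₁ (framed j)

          lands-after : ∀ n → ∃[ j ] n ≤ j × D (suc (j + start)) ≡ d
          lands-after n with lands (n + start)
          ... | m , n+start≤m , eq =
            m ∸ start , m+n≤o⇒m≤o∸n n n+start≤m ,
            subst (λ k → D (suc k) ≡ d) (sym (m∸n+n≡m (≤-trans (m≤n+m start n) n+start≤m))) eq

          ν-impossible : ¬ (Binder.kind b ≡ ν)
          ν-impossible isν = no-infinite-descent ≺-wellFounded stages
            (λ j → Advances.weak (advances j) isν)
            λ n → let j , n≤j , eq = lands-after n
                  in j , n≤j , Advances.strict (advances j) eq isν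

          name-recurs : InfinitelyOften (Binder.name b) π
          name-recurs n = let j , n≤j , eq = lands-after n in
            j + start , ≤-trans n≤j (m≤m+n j start) ,
            Advances.named (advances j) eq

          -- A recurring `Y` is unfolded at some move after `start`, when the frame at `d` still
          -- belongs to `b`.
          outermost : ∀ {Y θ χ} → InfinitelyOften Y π → fix θ Y χ ∈Sub φ →
            fix θ Y χ ∈Sub fix (Binder.kind b) (Binder.name b) (Binder.scope b)
          outermost recurs-Y o with recurs-Y start
          ... | m , start≤m , isY =
            enclosed (moves m) isY (x (suc m))
              (proj₂ (subst (λ k → ∃[ α ] frameˢ (x (suc k)) d ≡ just (b , α))
                            (m∸n+n≡m start≤m) (framed (suc (m ∸ start))))) o

        adam-wins : OutermostIs μ π
        -- A move landing at depth `d` after `N` cannot descend, so it unfolds a binder; that binder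
        -- is the outermost one.
        adam-wins with lands N
        ... | k , N≤k , eq
          with landing (progress k) (subst (_≤ D k) (sym eq) (above N≤k))
        ... | b , α , framed with subst (λ d → frameˢ (x (suc k)) d ≡ just (b , α)) eq framed
        ... | framed₀ with b
        ... | binder {μ} at-b = _ , _ , at-b ,
              name-recurs (binder at-b) (suc k) (≤-trans N≤k (n≤1+n k)) α framed₀ ,
              outermost (binder at-b) (suc k) (≤-trans N≤k (n≤1+n k)) α framed₀
        ... | binder {ν} at-b = contradiction refl
              (ν-impossible (binder at-b) (suc k) (≤-trans N≤k (n≤1+n k)) α framed₀)

    adam-wins-infinite : ∀ π (ρ : ∀ n → Run (history π n) (π n)) →
      (∀ n → Respects strategy (ρ n)) → OutermostIs μ π
    adam-wins-infinite π ρ respects =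
      let d , (N , above) , recurs =
            recurring-minimum em (λ n → depthᶜ (π n)) (height φ) (λ n → depth≤height (occurrence (π n)))
      in Infinite.adam-wins π (λ n → last-move (ρ (suc n))) x progress d N above recurs
      where
      x : ∀ n → State (π n)
      x n = proj₁ (tracked (ρ n) (respects n))
      progress : ∀ n → Progress (x n) (x (suc n))
      progress n = follow-progress
        (trans (cong (λ s → follow s (π (suc n))) (sym (proj₂ (tracked (ρ n) (respects n)))))
               (proj₂ (tracked (ρ (suc n)) (respects (suc n)))))

    adam-wins-finite : ∀ {h C} (ρ : Run h C) → Stuck C → Respects strategy ρ →
      AdamWinsAt (process C) (formula C)
    adam-wins-finite ρ stuck respects = adam-wins-stuck (proj₁ (tracked ρ respects)) stuck

    winning : AdamHasWinningStrategy
    winning = strategy , λ where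
      (finite ρ stuck) respects → adam-wins-finite ρ stuck respects
      (infinite π ρ)   respects → adam-wins-infinite π ρ respects

theorem6 : (em : ExcludedMiddle 0ℓ) (𝔗 : TSI) (Var : Set) → ImageFinite 𝔗 →
    let open TFL em 𝔗 Var in
    (𝒱 : Valuation) (φ : PNF) → WellFormed ⌜ φ ⌝ → Unique (binders φ) →
    initialProcess ∉ ⟦ ⌜ φ ⌝ ⟧ 𝒱 → Game.AdamHasWinningStrategy 𝒱 initialProcess φ
theorem6 em 𝔗 Var _ 𝒱 φ wellFormed unique h =
  WinningStrategy.winning 𝒱 initialProcess φ (bindsPositively φ wellFormed) unique
    (refute φ (λ Z → (λ H∉ → H∉) , λ H∉ → H∉) h)
  where
  open TFL em 𝔗 Var
  open Refutation em 𝔗 Var
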